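{- Fix positive integers $p,q$ such that $2 < \frac{p}{q} < 4$. A graph $G$ is $(p,q)$-mixing if and only if for every $(p,q)$-colouring $f$ of $G$ and for every cycle $C$ in $G$, the wind of $C$ under $f$ satisfies $w_f(C) = \frac{|E(C)|}{2}$.
   Context: Graphs are finite and simple. A $(p,q)$-colouring of $G$ is a map $f: V(G) \to \{0,1,\dots,p-1\}$ such that $q \leq |f(u)-f(v)| \leq p-q$ for every edge $uv$. $G$ is $(p,q)$-mixing if any two $(p,q)$-colourings $f,g$ of $G$ are joined by a finite sequence of $(p,q)$-colourings of $G$ in which consecutive colourings differ on at most one vertex (vacuously true if $G$ has no $(p,q)$-colouring). For an edge $uv$ (with direction from $u$ to $v$), its weight is $W(uv,f) = (f(v)-f(u)) \bmod p \in \{0,\dots,p-1\}$. For a cycle $C = c_0,c_1,\dots,c_{l-1},c_0$ (traversed in a given direction), $W(C,f)$ is the sum of the weights of its $l$ edges directed consistently along the traversal; this is an integer multiple of $p$, and the wind $w_f(C)$ is the integer with $W(C,f) = p\cdot w_f(C)$. (Reversing the direction replaces $w_f(C)$ by $|E(C)|-w_f(C)$, so the condition $w_f(C)=|E(C)|/2$ does not depend on the direction.) -}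

module Defs where

open import Data.Fin.Base using (Fin; zero; suc; toℕ; fromℕ; inject₁)
open import Data.Fin.Properties
  using (toℕ-injective; toℕ-fromℕ<; toℕ-fromℕ; toℕ-inject₁; toℕ<n)
open import Data.Integer.Base as ℤ using (ℤ; +_)
open import Data.Integer.DivMod using (_%ℕ_; _/ℕ_; a≡a%ℕn+[a/ℕn]*n)
import Data.Integer.Divisibility.Signed as Signed
import Data.Integer.Properties as ℤ
open import Data.Integer.Tactic.RingSolver using (solve-∀)
open import Data.Nat.Base using (ℕ; zero; suc; _+_; _*_; _∸_; _≤_; s≤s; ∣_-_∣; NonZero)
open import Data.Nat.Divisibility using (_∣_; quotient)
open import Data.Nat.DivMod using (_%_; _mod_; m%n<n; m<n⇒m%n≡m; n%n≡0)
open import Data.Nat.Properties using (+-0-commutativeMonoid; +-comm; *-comm)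
open import Algebra.Properties.CommutativeMonoid.Sum +-0-commutativeMonoid
  using (sum; sum-init-last; sum-cong-≗)
open import Data.Product.Base using (∃; _×_; _,_)
open import Function.Base using (_∘_)
open import Function.Definitions using (Injective)
open import Level using (0ℓ)
open import Relation.Binary.Construct.Closure.ReflexiveTransitive using (Star)
open import Relation.Binary.Core using (Rel)
open import Relation.Binary.Definitions using (Decidable; Symmetric)
open import Relation.Binary.PropositionalEquality
  using (_≡_; _≢_; refl; sym; trans; cong; cong₂; module ≡-Reasoning)
open import Relation.Nullary.Negation using (¬_)

record Graph : Set₁ where
  field
    order  : ℕ
    Adj    : Rel (Fin order) 0ℓ
    adj?   : Decidable Adj
    symm   : Symmetric Adj
    irrefl : ∀ v → ¬ Adj v v

  Vertex : Set
  Vertex = Fin order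

open Graph using (Vertex; Adj)

record Colouring (p q : ℕ) (G : Graph) : Set where
  field
    colour : Vertex G → Fin p
    proper : ∀ u v → Adj G u v →
             q ≤ ∣ toℕ (colour u) - toℕ (colour v) ∣ ×
             ∣ toℕ (colour u) - toℕ (colour v) ∣ ≤ p ∸ q

open Colouring

module _ {p q : ℕ} {G : Graph} where

  DifferOnAtMostOneVertex : Rel (Colouring p q G) 0ℓ
  DifferOnAtMostOneVertex f g =
    ∀ u v → colour f u ≢ colour g u → colour f v ≢ colour g v → u ≡ v

-- Two colourings with pointwise equal colours are related by a single step, so
-- `Star` does not depend on propositional equality of `Colouring` records.
Mixing : (p q : ℕ) → Graph → Set
Mixing p q G = (f g : Colouring p q G) → Star DifferOnAtMostOneVertex f g

next : ∀ {l} → Fin l → Fin l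
next {suc l} i = suc (toℕ i) mod suc l

-- A cycle comes with a starting vertex and a direction of traversal.  As it has
-- at least three vertices, all distinct, `length` is also its number of edges.
record Cycle (G : Graph) : Set where
  field
    length    : ℕ
    length≥3  : 3 ≤ length
    vertex    : Fin length → Vertex G
    injective : Injective _≡_ _≡_ vertex
    adjacent  : ∀ i → Adj G (vertex i) (vertex (next i))

  ∣E∣ : ℕ
  ∣E∣ = length

open Cycle using (length; vertex)

module _ {l : ℕ} where

  next-inject₁ : (i : Fin l) → next (inject₁ i) ≡ suc i
  next-inject₁ i = toℕ-injective (begin
    toℕ (next (inject₁ i))             ≡⟨ toℕ-fromℕ< (m%n<n (suc (toℕ (inject₁ i))) (suc l)) ⟩
    suc (toℕ (inject₁ i)) % suc l  ≡⟨ cong (λ k → suc k % suc l) (toℕ-inject₁ i) ⟩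
    suc (toℕ i) % suc l            ≡⟨ m<n⇒m%n≡m (s≤s (toℕ<n i)) ⟩
    suc (toℕ i)                        ∎)
    where open ≡-Reasoning

  next-fromℕ : next (fromℕ l) ≡ zero
  next-fromℕ = toℕ-injective (begin
    toℕ (next (fromℕ l))             ≡⟨ toℕ-fromℕ< (m%n<n (suc (toℕ (fromℕ l))) (suc l)) ⟩
    suc (toℕ (fromℕ l)) % suc l  ≡⟨ cong (λ k → suc k % suc l) (toℕ-fromℕ l) ⟩
    suc l % suc l                ≡⟨ n%n≡0 (suc l) ⟩
    0                                ∎)
    where open ≡-Reasoning

sum-next : ∀ {l} (a : Fin l → ℕ) → sum (a ∘ next) ≡ sum a
sum-next {zero} a = refl
sum-next {suc l}  a = begin
  sum (a ∘ next)                                    ≡⟨ sum-init-last (a ∘ next) ⟩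
  sum (a ∘ next ∘ inject₁) + a (next (fromℕ l))     ≡⟨ cong₂ _+_ (sum-cong-≗ (cong a ∘ next-inject₁)) (cong a next-fromℕ) ⟩
  sum (a ∘ suc) + a zero                            ≡⟨ +-comm (sum (a ∘ suc)) (a zero) ⟩
  sum a                                             ∎
  where open ≡-Reasoning

module _ {p q : ℕ} .{{_ : NonZero p}} {G : Graph} (f : Colouring p q G) where

  weight : Vertex G → Vertex G → ℕ
  weight u v = (+ toℕ (colour f v) ℤ.- + toℕ (colour f u)) %ℕ p

  cycleWeight : Cycle G → ℕ
  cycleWeight C = sum (λ i → weight (vertex C i) (vertex C (next i)))

sum-residues : ∀ (p : ℕ) .{{_ : NonZero p}} {l} (a b : Fin l → ℕ) →
  ∃ λ k → + sum (λ i → (+ b i ℤ.- + a i) %ℕ p) ℤ.+ k ℤ.* + p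
          ≡ + sum b ℤ.- + sum a
sum-residues p {zero} a b = + 0 , refl
sum-residues p {suc l} a b with sum-residues p (a ∘ suc) (b ∘ suc)
... | k , ih = d /ℕ p ℤ.+ k , (begin
  + (r + R) ℤ.+ (d /ℕ p ℤ.+ k) ℤ.* + p
    ≡⟨ cong (ℤ._+ (d /ℕ p ℤ.+ k) ℤ.* + p) (ℤ.pos-+ r R) ⟩
  (+ r ℤ.+ + R) ℤ.+ (d /ℕ p ℤ.+ k) ℤ.* + p
    ≡⟨ regroup (+ r) (+ R) (d /ℕ p) k (+ p) ⟩
  (+ r ℤ.+ d /ℕ p ℤ.* + p) ℤ.+ (+ R ℤ.+ k ℤ.* + p)
    ≡⟨ cong₂ ℤ._+_ (sym (a≡a%ℕn+[a/ℕn]*n d p)) ih ⟩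
  (+ b zero ℤ.- + a zero) ℤ.+ (+ B ℤ.- + A)
    ≡⟨ interchange (+ b zero) (+ a zero) (+ B) (+ A) ⟩
  (+ b zero ℤ.+ + B) ℤ.- (+ a zero ℤ.+ + A)
    ≡⟨ cong₂ ℤ._-_ (ℤ.pos-+ (b zero) B) (ℤ.pos-+ (a zero) A) ⟨
  + (b zero + B) ℤ.- + (a zero + A) ∎)
  where
  open ≡-Reasoning
  d = + b zero ℤ.- + a zero
  r = d %ℕ p
  R = sum (λ i → (+ b (suc i) ℤ.- + a (suc i)) %ℕ p)
  A = sum (a ∘ suc)
  B = sum (b ∘ suc)
  regroup : ∀ r R x k p →
    (r ℤ.+ R) ℤ.+ (x ℤ.+ k) ℤ.* p ≡ (r ℤ.+ x ℤ.* p) ℤ.+ (R ℤ.+ k ℤ.* p)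
  regroup = solve-∀
  interchange : ∀ b a B A →
    (b ℤ.- a) ℤ.+ (B ℤ.- A) ≡ (b ℤ.+ B) ℤ.- (a ℤ.+ A)
  interchange = solve-∀

module _ {p q : ℕ} .{{_ : NonZero p}} {G : Graph} (f : Colouring p q G) where

  p∣cycleWeight : (C : Cycle G) → p ∣ cycleWeight f C
  p∣cycleWeight C = divides′ (sum-residues p a (a ∘ next))
    where
    open ≡-Reasoning
    a : Fin (length C) → ℕ
    a i = toℕ (colour f (vertex C i))
    W = cycleWeight f C
    cancel : ∀ W x → W ≡ (W ℤ.+ x) ℤ.+ ℤ.- x
    cancel = solve-∀
    divides′ : (∃ λ k → + W ℤ.+ k ℤ.* + p ≡ + sum (a ∘ next) ℤ.- + sum a) → p ∣ W
    divides′ (k , eq) = Signed.∣⇒∣ᵤ (Signed.divides (ℤ.- k) (begin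
      + W                                                ≡⟨ cancel (+ W) (k ℤ.* + p) ⟩
      (+ W ℤ.+ k ℤ.* + p) ℤ.+ ℤ.- (k ℤ.* + p)            ≡⟨ cong (ℤ._+ ℤ.- (k ℤ.* + p)) eq ⟩
      (+ sum (a ∘ next) ℤ.- + sum a) ℤ.+ ℤ.- (k ℤ.* + p) ≡⟨ cong (λ s → (+ s ℤ.- + sum a) ℤ.+ ℤ.- (k ℤ.* + p)) (sum-next a) ⟩
      (+ sum a ℤ.- + sum a) ℤ.+ ℤ.- (k ℤ.* + p)          ≡⟨ cong (ℤ._+ ℤ.- (k ℤ.* + p)) (ℤ.+-inverseʳ (+ sum a)) ⟩
      + 0 ℤ.+ ℤ.- (k ℤ.* + p)                            ≡⟨ ℤ.+-identityˡ _ ⟩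
      ℤ.- (k ℤ.* + p)                                    ≡⟨ ℤ.neg-distribˡ-* k (+ p) ⟩
      ℤ.- k ℤ.* + p                                      ∎))

  wind : Cycle G → ℕ
  wind C = quotient (p∣cycleWeight C)

  cycleWeight≡p*wind : (C : Cycle G) → cycleWeight f C ≡ p * wind C
  cycleWeight≡p*wind C = trans (_∣_.equality (p∣cycleWeight C)) (*-comm (wind C) p)

{-# OPTIONS --safe #-}
-- (⇒) Reversing the order of the colours turns wind w into |E(C)| − w.  A single
-- recolouring changes the weights of consecutive edges of a cycle by opposite
-- amounts, as the weights lie in [q, p − q] and p < 4q; so mixing preserves winds.
--
-- (⇐) If all winds are |E(C)|/2, every closed walk of length 2m has weight m p.
-- Hence G is bipartite and, along paths of a spanning forest, colours lift to
-- heights k : V(G) → ℕ such that q ≤ k(v) − k(u) ≤ p − q on the edges directed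
-- from the first side to the second.  Given two such k ≤ l, among the vertices
-- with k < l take the one which is lowest when heights on the first side are
-- raised by p/2: as 2q < p, no neighbour prevents raising it by one.  So any two
-- heights are connected through their maximum.
module Submission where

open import Defs
open import Data.Fin.Base using (Fin; zero; suc; toℕ; fromℕ; inject₁; opposite)
open import Data.Fin.Properties
  using (_≟_; toℕ<n; toℕ-injective; toℕ-fromℕ<; opposite-prop)
open import Data.Fin.Relation.Unary.Top using (view; ‵fromℕ; ‵inject₁)
open import Data.Integer.Base as ℤ using (+_; -[1+_])
open import Data.Integer.DivMod using (_%ℕ_; _/ℕ_; a≡a%ℕn+[a/ℕn]*n; n%ℕd<d)
import Data.Integer.Properties as ℤ
import Data.Integer.Tactic.RingSolver as ℤ-Solver
open import Data.List.Base as List using (allFin; cartesianProduct)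
open import Data.List.Membership.Propositional.Properties
  using (∈-allFin; ∈-cartesianProduct⁺)
open import Data.List.Relation.Unary.All as All using (All)
open import Data.Nat.Base as ℕ hiding (_<_; _/_; parity)
open import Data.Nat.DivMod
  using (DivMod; _divMod_; _mod_; m%n<n; m%n%n≡m%n; m*n%n≡0; m<n⇒m%n≡m;
         [m+n]%n≡m%n; [m+kn]%n≡m%n; %-distribˡ-+)
open import Data.Nat.Properties hiding (_≟_)
open import Data.Nat.Tactic.RingSolver using (solve-∀)
open import Data.Product.Base using (Σ; ∃; _×_; _,_; proj₁; proj₂)
open import Data.Rational.Unnormalised.Base using (_/_; _<_; _≃_; *≡*)
open import Data.Rational.Unnormalised.Properties using (drop-*<*; drop-*≡*)
open import Data.Sum.Base using (_⊎_; inj₁; inj₂)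
open import Data.Unit.Base using (⊤; tt)
open import Data.Vec.Functional using (updateAt)
open import Data.Vec.Functional.Properties using (updateAt-updates; updateAt-minimal)
open import Function.Base using (_∘_)
open import Function.Bundles using (_⇔_; mk⇔)
open import Function.Definitions using (Injective)
open import Relation.Binary.Construct.Closure.ReflexiveTransitive as Star
  using (Star; ε; _◅_; _◅◅_)
open import Relation.Binary.PropositionalEquality
  using (_≡_; _≢_; refl; sym; trans; cong; cong₂; subst; subst₂; module ≡-Reasoning)
open import Relation.Nullary.Decidable.Core using (Dec; yes; no; _⊎-dec_)
open import Relation.Nullary.Negation.Core using (¬_; contradiction)
open import Relation.Unary using (Decidable)

open import Algebra.Properties.CommutativeMonoid.Sum +-0-commutativeMonoid
  using (sum; sum-cong-≗; ∑-distrib-+; sum-init-last)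

-- Walks and cycles

module _ {G : Graph} where

  open Graph G

  infixr 5 _∷_ _++_

  data Walk : Vertex → Vertex → Set where
    []  : ∀ {u} → Walk u u
    _∷_ : ∀ {u v w} → Adj u v → Walk v w → Walk u w

  _++_ : ∀ {u v w} → Walk u v → Walk v w → Walk u w
  []      ++ y = y
  (e ∷ x) ++ y = e ∷ (x ++ y)

  reverse : ∀ {u v} → Walk u v → Walk v u
  reverse []      = []
  reverse (e ∷ x) = reverse x ++ (symm e ∷ [])

  total : (Vertex → Vertex → ℕ) → ∀ {u v} → Walk u v → ℕ
  total ω []                  = 0
  total ω (_∷_ {u} {v} e x) = ω u v + total ω x

  length : ∀ {u v} → Walk u v → ℕ
  length = total (λ _ _ → 1)

  total-++ : ∀ ω {u v w} (x : Walk u v) (y : Walk v w) →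
    total ω (x ++ y) ≡ total ω x + total ω y
  total-++ ω []                  y = refl
  total-++ ω (_∷_ {u} {v} e x) y =
    trans (cong (λ t → ω u v + t) (total-++ ω x y)) (sym (+-assoc (ω u v) _ _))

  -- The two directions of an edge contribute `p` together. Stated as a sum, this avoids subtracting
  -- from `length x * p`.
  total-reverse : ∀ {ω p} → (∀ {u v} → Adj u v → ω u v + ω v u ≡ p) →
    ∀ {u v} (x : Walk u v) → total ω (reverse x) + total ω x ≡ length x * p
  total-reverse anti [] = refl
  total-reverse {ω} {p} anti (_∷_ {u} {v} e x) = begin
    total ω (reverse x ++ symm e ∷ []) + (ω u v + total ω x)
      ≡⟨ cong (_+ (ω u v + total ω x)) (total-++ ω (reverse x) (symm e ∷ [])) ⟩
    total ω (reverse x) + (ω v u + 0) + (ω u v + total ω x)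
      ≡⟨ regroup (total ω (reverse x)) (ω v u) (ω u v) (total ω x) ⟩
    (ω u v + ω v u) + (total ω (reverse x) + total ω x)
      ≡⟨ cong₂ _+_ (anti e) (total-reverse anti x) ⟩
    p + length x * p                                          ∎
    where
    open ≡-Reasoning
    regroup : ∀ a b c d → a + (b + 0) + (c + d) ≡ (c + b) + (a + d)
    regroup = solve-∀

  length-reverse : ∀ {u v} (x : Walk u v) → length (reverse x) ≡ length x
  length-reverse x = +-cancelʳ-≡ (length x) _ _
    -- The constant weight 1 satisfies the antisymmetry with `p = 2`.
    (trans (total-reverse (λ _ → refl) x) (double (length x)))
    where
    double : ∀ n → n * 2 ≡ n + n
    double = solve-∀

  infix 4 _∈_ _∈?_

  _∈_ : Vertex → ∀ {u v} → Walk u v → Set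
  x ∈ ([] {u})      = x ≡ u
  x ∈ (_∷_ {u} e y) = x ≡ u ⊎ x ∈ y

  _∈?_ : ∀ x {u v} (y : Walk u v) → Dec (x ∈ y)
  x ∈? ([] {u})      = x ≟ u
  x ∈? (_∷_ {u} e y) = x ≟ u ⊎-dec x ∈? y

  ∈-last : ∀ {u v} (y : Walk u v) → v ∈ y
  ∈-last []      = refl
  ∈-last (e ∷ y) = inj₂ (∈-last y)

  ∈-++⁺ˡ : ∀ {x u v w} (y : Walk u v) (z : Walk v w) → x ∈ y → x ∈ (y ++ z)
  ∈-++⁺ˡ []      []      x≡u        = x≡u
  ∈-++⁺ˡ []      (e ∷ z) x≡u        = inj₁ x≡u
  ∈-++⁺ˡ (e ∷ y) z       (inj₁ x≡u) = inj₁ x≡u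
  ∈-++⁺ˡ (e ∷ y) z       (inj₂ x∈y) = inj₂ (∈-++⁺ˡ y z x∈y)

  ∈-split : ∀ {x u v} (y : Walk u v) → x ∈ y →
    Σ (Walk u x) λ y₁ → Σ (Walk x v) λ y₂ → y₁ ++ y₂ ≡ y
  ∈-split []      refl        = [] , [] , refl
  ∈-split (e ∷ y) (inj₁ refl) = [] , e ∷ y , refl
  ∈-split (e ∷ y) (inj₂ x∈y) with ∈-split y x∈y
  ... | y₁ , y₂ , eq = e ∷ y₁ , y₂ , cong (e ∷_) eq

  -- The endpoint counts as well, so a closed walk is simple only if it is empty.
  Simple : ∀ {u v} → Walk u v → Set
  Simple []            = ⊤
  Simple (_∷_ {u} e x) = ¬ u ∈ x × Simple x

  Simple-++⁻ : ∀ {u v w} (x : Walk u v) (y : Walk v w) → Simple (x ++ y) → Simple x × Simple y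
  Simple-++⁻ []      y s         = tt , s
  Simple-++⁻ (e ∷ x) y (u∉ , s) with Simple-++⁻ x y s
  ... | sx , sy = (u∉ ∘ ∈-++⁺ˡ x y , sx) , sy

  at : ∀ {u v} (x : Walk u v) → Fin (suc (length x)) → Vertex
  at ([] {u})      zero    = u
  at (_∷_ {u} e x) zero    = u
  at (e ∷ x)       (suc i) = at x i

  at-first : ∀ {u v} (x : Walk u v) → at x zero ≡ u
  at-first []      = refl
  at-first (e ∷ x) = refl

  at-last : ∀ {u v} (x : Walk u v) → at x (fromℕ (length x)) ≡ v
  at-last []      = refl
  at-last (e ∷ x) = at-last x

  at-∈ : ∀ {u v} (x : Walk u v) i → at x i ∈ x
  at-∈ []      zero    = refl
  at-∈ (e ∷ x) zero    = inj₁ refl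
  at-∈ (e ∷ x) (suc i) = inj₂ (at-∈ x i)

  at-adjacent : ∀ {u v} (x : Walk u v) i → Adj (at x (inject₁ i)) (at x (suc i))
  at-adjacent (_∷_ {u} e x) zero    = subst (Adj u) (sym (at-first x)) e
  at-adjacent (e ∷ x)       (suc i) = at-adjacent x i

  at-injective : ∀ {u v} (x : Walk u v) → Simple x → Injective _≡_ _≡_ (at x)
  at-injective []      s        {zero}  {zero}  eq = refl
  at-injective (e ∷ x) s        {zero}  {zero}  eq = refl
  at-injective (e ∷ x) (u∉ , s) {zero}  {suc j} eq = contradiction (subst (_∈ x) (sym eq) (at-∈ x j)) u∉
  at-injective (e ∷ x) (u∉ , s) {suc i} {zero}  eq = contradiction (subst (_∈ x) eq (at-∈ x i)) u∉
  at-injective (e ∷ x) (u∉ , s) {suc i} {suc j} eq = cong suc (at-injective x s eq)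

  sum-at : ∀ ω {u v} (x : Walk u v) →
    sum (λ i → ω (at x (inject₁ i)) (at x (suc i))) ≡ total ω x
  sum-at ω []                = refl
  sum-at ω (_∷_ {u} {v} e x) = cong₂ _+_ (cong (ω u) (at-first x)) (sum-at ω x)

  module _ {u v : Vertex} (x : Walk u v) (simple : Simple x) (2≤length : 2 ≤ length x) (e : Adj v u) where

    closeUp : Cycle G
    closeUp = record
      { length    = suc (length x)
      ; length≥3  = s≤s 2≤length
      ; vertex    = at x
      ; injective = at-injective x simple
      ; adjacent  = adjacent
      }
      where
      adjacent : ∀ i → Adj (at x i) (at x (next i))
      adjacent i with view i
      ... | ‵fromℕ     = subst₂ Adj (sym (at-last x)) (sym (trans (cong (at x) next-fromℕ) (at-first x))) e
      ... | ‵inject₁ j = subst (λ k → Adj (at x (inject₁ j)) (at x k)) (sym (next-inject₁ j)) (at-adjacent x j)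

    sum-closeUp : ∀ ω → sum (λ i → ω (at x i) (at x (next i))) ≡ ω v u + total ω x
    sum-closeUp ω = begin
      sum (λ i → ω (at x i) (at x (next i)))
        ≡⟨ sum-init-last (λ i → ω (at x i) (at x (next i))) ⟩
      sum (λ i → ω (at x (inject₁ i)) (at x (next (inject₁ i)))) +
      ω (at x (fromℕ (length x))) (at x (next (fromℕ (length x))))
        ≡⟨ cong₂ _+_
             (sum-cong-≗ (λ i → cong (λ k → ω (at x (inject₁ i)) (at x k)) (next-inject₁ i)))
             (cong₂ ω (at-last x) (trans (cong (at x) next-fromℕ) (at-first x))) ⟩
      sum (λ i → ω (at x (inject₁ i)) (at x (suc i))) + ω v u
        ≡⟨ cong (_+ ω v u) (sum-at ω x) ⟩
      total ω x + ω v u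
        ≡⟨ +-comm (total ω x) (ω v u) ⟩
      ω v u + total ω x ∎
      where open ≡-Reasoning

  aroundCycle : (Vertex → Vertex → ℕ) → Cycle G → ℕ
  aroundCycle ω C = sum (λ i → ω (vertex i) (vertex (next i)))
    where open Cycle C using (vertex)

  module _ (p : ℕ) where

    -- An average of `p / 2` per edge over an even number of edges. For a cycle and its weight, the
    -- witness `m` is the wind.
    Balanced : ℕ → ℕ → Set
    Balanced l t = ∃ λ m → l ≡ m * 2 × t ≡ m * p

    module _ (ω : Vertex → Vertex → ℕ)
      (anti : ∀ {u v : Vertex} → Adj u v → ω u v + ω v u ≡ p)
      (cycles : (C : Cycle G) → Balanced (Cycle.∣E∣ C) (aroundCycle ω C))
      where

      -- Closed walks of length 1 and 2 are no `Cycle`: the first would be a loop, the second runs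
      -- an edge forth and back and is balanced by `anti`.
      closeUp-balanced : ∀ {u v} (x : Walk u v) → Simple x → (e : Adj v u) →
        Balanced (suc (length x)) (ω v u + total ω x)
      closeUp-balanced {u} [] s e = contradiction e (irrefl u)
      closeUp-balanced {u} {v} (e′ ∷ []) s e =
        1 , refl , trans (cong (λ t → ω v u + t) (+-identityʳ (ω u v))) (trans (anti e) (sym (*-identityˡ p)))
      closeUp-balanced x@(_ ∷ _ ∷ _) s e =
        subst (Balanced (suc (length x))) (sum-closeUp x s (s≤s (s≤s z≤n)) e ω)
          (cycles (closeUp x s (s≤s (s≤s z≤n)) e))

      -- A simple walk in the place of x arises by cutting off the cycles which x
      -- closes; each of them is balanced.
      simplify : ∀ {u v} (x : Walk u v) → Σ (Walk u v) λ y → Simple y ×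
        ∃ λ m → length x ≡ m * 2 + length y × total ω x ≡ m * p + total ω y
      simplify [] = [] , tt , 0 , refl , refl
      simplify (_∷_ {u} {v} e x) with simplify x
      ... | y , s , m , l≡ , t≡ with u ∈? y
      ...   | no u∉y  = e ∷ y , (u∉y , s) , m ,
        trans (cong suc l≡) (sym (+-suc (m * 2) (length y))) ,
        trans (cong (λ t → ω u v + t) t≡) (swap (ω u v) (m * p) (total ω y))
        where
        swap : ∀ a b c → a + (b + c) ≡ b + (a + c)
        swap = solve-∀
      ...   | yes u∈y with ∈-split y u∈y
      ...     | y₁ , y₂ , refl with Simple-++⁻ y₁ y₂ s
      ...       | s₁ , s₂ with closeUp-balanced y₁ s₁ e
      ...         | n , l₁≡ , t₁≡ = y₂ , s₂ , n + m ,
        combine 1 (length x) l≡ (total-++ _ y₁ y₂) l₁≡ ,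
        combine (ω u v) (total ω x) t≡ (total-++ ω y₁ y₂) t₁≡
        where
        open ≡-Reasoning
        regroup : ∀ w a m c y → w + (m * c + (a + y)) ≡ (w + a) + (m * c + y)
        regroup = solve-∀
        collect : ∀ n m c y → n * c + (m * c + y) ≡ (n + m) * c + y
        collect = solve-∀
        -- Used twice: for the length, with an edge worth 1 and `c = 2`, and for the weight, with
        -- `c = p`.
        combine : ∀ w t {c a b ab} → t ≡ m * c + ab → ab ≡ a + b → w + a ≡ n * c →
          w + t ≡ (n + m) * c + b
        combine w t {c} {a} {b} refl refl wa≡ = begin
          w + (m * c + (a + b))    ≡⟨ regroup w a m c b ⟩
          (w + a) + (m * c + b)    ≡⟨ cong (_+ (m * c + b)) wa≡ ⟩
          n * c + (m * c + b)      ≡⟨ collect n m c b ⟩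
          (n + m) * c + b          ∎

      -- Simplifying a closed walk leaves the empty one, so its length and weight are those of the
      -- balanced pieces cut off.
      closed-balanced : ∀ {u} (x : Walk u u) → Balanced (length x) (total ω x)
      closed-balanced x with simplify x
      ... | []    , s         , m , l≡ , t≡ = m , trans l≡ (+-identityʳ (m * 2)) , trans t≡ (+-identityʳ (m * p))
      ... | e ∷ y , (u∉y , s) , _           = contradiction (∈-last y) u∉y

      -- The closed walk runs along `x`, across the edge and back along `y`; adding `total ω y` to
      -- its weight turns the way back into `length y * p`. The starting points are equated by a
      -- hypothesis because the roots of adjacent vertices are only propositionally equal.
      edge-balanced : ∀ {r r′ u v} → r ≡ r′ → (x : Walk r u) (y : Walk r′ v) → Adj u v →
        ∃ λ m → length x + suc (length y) ≡ m * 2 ×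
                total ω x + ω u v + length y * p ≡ m * p + total ω y
      edge-balanced {u = u} {v} refl x y e with closed-balanced (x ++ e ∷ reverse y)
      ... | m , l≡ , t≡ = m ,
        trans (cong (λ l → length x + suc l) (sym (length-reverse y)))
          (trans (sym (total-++ _ x (e ∷ reverse y))) l≡) ,
        (begin
          total ω x + ω u v + length y * p
            ≡⟨ cong (λ t → total ω x + ω u v + t) (total-reverse anti y) ⟨
          total ω x + ω u v + (total ω (reverse y) + total ω y)
            ≡⟨ regroup (total ω x) (ω u v) (total ω (reverse y)) (total ω y) ⟩
          total ω x + (ω u v + total ω (reverse y)) + total ω y
            ≡⟨ cong (_+ total ω y) (total-++ ω x (e ∷ reverse y)) ⟨
          total ω (x ++ e ∷ reverse y) + total ω y                  ≡⟨ cong (_+ total ω y) t≡ ⟩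
          m * p + total ω y                                         ∎)
        where
        open ≡-Reasoning
        regroup : ∀ a b c d → a + b + (c + d) ≡ a + (b + c) + d
        regroup = solve-∀

-- Spanning forests

module _ (G : Graph) where

  open Graph G

  -- Only the paths from the roots are recorded; vertices count as lying in the same tree when their
  -- roots are equal.
  record Forest : Set where
    field
      root : Vertex → Vertex
      path : ∀ v → Walk {G} (root v) v

  open Forest

  Connects : Forest → Vertex × Vertex → Set
  Connects F (u , v) = Adj u v → root F u ≡ root F v

  -- If `uv` is an edge, the tree of `u` is hung below the root of `v`. The new root is a function
  -- of the old one, so equal roots stay equal.
  merge : ∀ (F : Forest) u v → Σ Forest λ F′ → Connects F′ (u , v) ×
    (∀ {xy} → Connects F xy → Connects F′ xy)
  merge F u v with adj? u v
  ... | no ¬e = F , (λ e → contradiction e ¬e) , λ c → c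
  ... | yes e = record { root = relabel ∘ root F ; path = λ x → extend (path F x) } ,
                (λ _ → trans relabel-u (sym relabel-v)) , λ c e → cong relabel (c e)
    where
    relabel : Vertex → Vertex
    relabel r with r ≟ root F u
    ... | yes _ = root F v
    ... | no  _ = r
    relabel-u : relabel (root F u) ≡ root F v
    relabel-u with root F u ≟ root F u
    ... | yes _ = refl
    ... | no ¬r = contradiction refl ¬r
    relabel-v : relabel (root F v) ≡ root F v
    relabel-v with root F v ≟ root F u
    ... | yes _ = refl
    ... | no  _ = refl
    extend : ∀ {r x} → Walk r x → Walk (relabel r) x
    extend {r} y with r ≟ root F u
    -- From the new root to `v`, across the edge to `u`, back to the old root, then along the old
    -- path.
    ... | yes refl = path F v ++ symm e ∷ (reverse (path F u) ++ y)
    ... | no  _    = y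

  connectAll : ∀ xys → Σ Forest λ F → All (Connects F) xys
  connectAll List.[] = record { root = λ v → v ; path = λ _ → [] } , All.[]
  connectAll ((u , v) List.∷ xys) with connectAll xys
  ... | F , cs with merge F u v
  ...   | F′ , c , keep = F′ , c All.∷ All.map keep cs

  spanningForest : Σ Forest λ F → ∀ {u v} → Adj u v → root F u ≡ root F v
  spanningForest with connectAll (cartesianProduct (allFin order) (allFin order))
  ... | F , cs = F , λ {u} {v} → All.lookup cs (∈-cartesianProduct⁺ (∈-allFin u) (∈-allFin v))

-- Residues modulo p

module _ (p : ℕ) .{{_ : NonZero p}} where

  residue-cases : ∀ {x z} → x ℕ.< p + p → z ℕ.< p → x % p ≡ z % p → x ≡ z ⊎ x ≡ z + p
  residue-cases {x} {z} x<2p z<p x≡z with x <? p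
  ... | yes x<p = inj₁ (trans (sym (m<n⇒m%n≡m x<p)) (trans x≡z (m<n⇒m%n≡m z<p)))
  ... | no x≮p with m≤n⇒∃[o]m+o≡n (≮⇒≥ x≮p)
  ...   | d , refl = inj₂ (trans (+-comm p d) (cong (_+ p) d≡z))
    where
    open ≡-Reasoning
    d≡z : d ≡ z
    d≡z = begin
      d            ≡⟨ m<n⇒m%n≡m (+-cancelˡ-< p d p x<2p) ⟨
      d % p        ≡⟨ [m+n]%n≡m%n d p ⟨
      (d + p) % p  ≡⟨ cong (_% p) (+-comm d p) ⟩
      (p + d) % p  ≡⟨ x≡z ⟩
      z % p        ≡⟨ m<n⇒m%n≡m z<p ⟩
      z            ∎

  +-congˡ-% : ∀ c {x y} → x % p ≡ y % p → (c + x) % p ≡ (c + y) % p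
  +-congˡ-% c {x} {y} x≡y = begin
    (c + x) % p          ≡⟨ %-distribˡ-+ c x p ⟩
    (c % p + x % p) % p  ≡⟨ cong (λ r → (c % p + r) % p) x≡y ⟩
    (c % p + y % p) % p  ≡⟨ %-distribˡ-+ c y p ⟨
    (c + y) % p          ∎
    where open ≡-Reasoning

  +-congʳ-% : ∀ c {x y} → x % p ≡ y % p → (x + c) % p ≡ (y + c) % p
  +-congʳ-% c {x} {y} x≡y = begin
    (x + c) % p  ≡⟨ cong (_% p) (+-comm x c) ⟩
    (c + x) % p  ≡⟨ +-congˡ-% c x≡y ⟩
    (c + y) % p  ≡⟨ cong (_% p) (+-comm c y) ⟩
    (y + c) % p  ∎
    where open ≡-Reasoning

  -- Adding `p ∸ a` completes `a` to `p`, which vanishes modulo `p`.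
  +-cancelˡ-% : ∀ {a x y} → a ≤ p → (a + x) % p ≡ (a + y) % p → x % p ≡ y % p
  +-cancelˡ-% {a} {x} {y} a≤p eq = begin
    x % p                  ≡⟨ shift x ⟨
    (p ∸ a + (a + x)) % p  ≡⟨ +-congˡ-% (p ∸ a) eq ⟩
    (p ∸ a + (a + y)) % p  ≡⟨ shift y ⟩
    y % p                  ∎
    where
    open ≡-Reasoning
    shift : ∀ z → (p ∸ a + (a + z)) % p ≡ z % p
    shift z = begin
      (p ∸ a + (a + z)) % p  ≡⟨ cong (_% p) (+-assoc (p ∸ a) a z) ⟨
      (p ∸ a + a + z) % p    ≡⟨ cong (λ s → (s + z) % p) (m∸n+n≡m a≤p) ⟩
      (p + z) % p            ≡⟨ cong (_% p) (+-comm p z) ⟩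
      (z + p) % p            ≡⟨ [m+n]%n≡m%n z p ⟩
      z % p                  ∎

  -- With the colours of `u` and `v` for `a` and `b`, this is by definition the `weight` from `u` to
  -- `v`.
  difference : ℕ → ℕ → ℕ
  difference a b = (+ b ℤ.- + a) %ℕ p

  difference<p : ∀ a b → difference a b ℕ.< p
  difference<p a b = n%ℕd<d (+ b ℤ.- + a) p

  a+difference : ∀ a b → (a + difference a b) % p ≡ b % p
  a+difference a b with (+ b ℤ.- + a) /ℕ p | a≡a%ℕn+[a/ℕn]*n (+ b ℤ.- + a) p
  -- The sign of the quotient decides which side receives the multiple of `p`, so that the equation
  -- can be read in ℕ.
  ... | + t      | eq = sym (trans (cong (_% p) (ℤ.+-injective b≡)) ([m+kn]%n≡m%n (a + difference a b) t p))
    where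
    open ≡-Reasoning
    r = difference a b
    b≡ : + b ≡ + (a + r + t * p)
    b≡ = begin
      + b                              ≡⟨ split (+ b) (+ a) ⟩
      + a ℤ.+ (+ b ℤ.- + a)            ≡⟨ cong (λ d → + a ℤ.+ d) eq ⟩
      + a ℤ.+ (+ r ℤ.+ + t ℤ.* + p)    ≡⟨ ℤ.+-assoc (+ a) (+ r) (+ t ℤ.* + p) ⟨
      + a ℤ.+ + r ℤ.+ + t ℤ.* + p      ≡⟨ cong (λ z → + a ℤ.+ + r ℤ.+ z) (ℤ.pos-* t p) ⟨
      + (a + r + t * p)                ∎
      where
      split : ∀ b a → b ≡ a ℤ.+ (b ℤ.- a)
      split = ℤ-Solver.solve-∀
  ... | -[1+ t ] | eq = trans (cong (_% p) (sym (ℤ.+-injective b≡))) ([m+kn]%n≡m%n b (suc t) p)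
    where
    open ≡-Reasoning
    r = difference a b
    b≡ : + (b + suc t * p) ≡ + (a + r)
    b≡ = begin
      + b ℤ.+ + (suc t * p)
        ≡⟨ cong (λ z → + b ℤ.+ z) (ℤ.pos-* (suc t) p) ⟩
      + b ℤ.+ + suc t ℤ.* + p
        ≡⟨ split (+ b) (+ a) (+ suc t ℤ.* + p) ⟩
      + a ℤ.+ (+ b ℤ.- + a) ℤ.+ + suc t ℤ.* + p
        ≡⟨ cong (λ d → + a ℤ.+ d ℤ.+ + suc t ℤ.* + p) eq ⟩
      + a ℤ.+ (+ r ℤ.+ -[1+ t ] ℤ.* + p) ℤ.+ + suc t ℤ.* + p ≡⟨ join (+ a) (+ r) (+ suc t) (+ p) ⟩
      + a ℤ.+ + r                                            ∎
      where
      split : ∀ b a c → b ℤ.+ c ≡ a ℤ.+ (b ℤ.- a) ℤ.+ c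
      split = ℤ-Solver.solve-∀
      join : ∀ a r t p → a ℤ.+ (r ℤ.+ ℤ.- t ℤ.* p) ℤ.+ t ℤ.* p ≡ a ℤ.+ r
      join = ℤ-Solver.solve-∀

  difference-cases : ∀ {a b} → a ℕ.< p → b ℕ.< p →
    a + difference a b ≡ b ⊎ a + difference a b ≡ b + p
  difference-cases {a} {b} a<p b<p =
    residue-cases (+-mono-< a<p (difference<p a b)) b<p (a+difference a b)

  difference-self : ∀ a → difference a a ≡ 0
  difference-self a = trans (cong (_%ℕ p) (ℤ.+-inverseʳ (+ a))) (m*n%n≡0 0 p)

  -- The sum is a multiple of `p` below `2p`, and positivity excludes 0.
  difference-antisym : ∀ {a b} → a ℕ.< p → b ℕ.< p → 0 ℕ.< difference a b →
    difference a b + difference b a ≡ p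
  difference-antisym {a} {b} a<p b<p 0<d = go (difference-cases a<p b<p) (difference-cases b<p a<p)
    where
    d = difference a b
    e = difference b a
    rot : ∀ {x} → a + d ≡ b + x → a + (d + e) ≡ (b + e) + x
    rot {x} eq = trans (sym (+-assoc a d e)) (trans (cong (_+ e) eq) (swap b x e))
      where
      swap : ∀ b x e → b + x + e ≡ b + e + x
      swap = solve-∀
    +0 : a + d ≡ b → a + d ≡ b + 0
    +0 eq = trans eq (sym (+-identityʳ b))
    go : a + d ≡ b ⊎ a + d ≡ b + p → b + e ≡ a ⊎ b + e ≡ a + p → d + e ≡ p
    go (inj₁ r) (inj₁ s) = contradiction (≤-trans 0<d (m≤m+n d e)) (<-irrefl (sym d+e≡0))
      where
      d+e≡0 : d + e ≡ 0
      d+e≡0 = +-cancelˡ-≡ a (d + e) 0 (trans (rot (+0 r)) (cong (_+ 0) s))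
    go (inj₁ r) (inj₂ s) = +-cancelˡ-≡ a (d + e) p (trans (rot (+0 r)) (trans (+-identityʳ _) s))
    go (inj₂ r) (inj₁ s) = +-cancelˡ-≡ a (d + e) p (trans (rot r) (cong (_+ p) s))
    go (inj₂ r) (inj₂ s) =
      contradiction (+-mono-< (difference<p a b) (difference<p b a)) (<-irrefl d+e≡2p)
      where
      d+e≡2p : d + e ≡ p + p
      d+e≡2p = +-cancelˡ-≡ a (d + e) (p + p)
        (trans (rot r) (trans (cong (_+ p) s) (+-assoc a p p)))

  module _ {a b d : ℕ} (d≤p : d ≤ p) where

    ∣a-b∣-cases : a + d ≡ b ⊎ a + d ≡ b + p → ∣ a - b ∣ ≡ d ⊎ ∣ a - b ∣ + d ≡ p
    ∣a-b∣-cases (inj₁ refl) = inj₁ (∣m-m+n∣≡n a d)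
    ∣a-b∣-cases (inj₂ eq)
      with m≤n⇒∃[o]m+o≡n (+-cancelʳ-≤ p b a (≤-trans (≤-reflexive (sym eq)) (+-monoʳ-≤ a d≤p)))
    ... | x , refl = inj₂ (begin
      ∣ b + x - b ∣ + d  ≡⟨ cong (_+ d) (trans (∣-∣-comm (b + x) b) (∣m-m+n∣≡n b x)) ⟩
      x + d              ≡⟨ +-cancelˡ-≡ b (x + d) p (trans (sym (+-assoc b x d)) eq) ⟩
      p                  ∎)
      where open ≡-Reasoning

  module _ (q : ℕ) where

    -- The interval from `q` to `p - q`, free of truncated subtraction. It is symmetric under
    -- complement to `p`, so it describes the weight of an edge in either direction.
    InWindow : ℕ → Set
    InWindow x = q ≤ x × x + q ≤ p

    InWindow-complement : ∀ {x y} → x + y ≡ p → InWindow x → InWindow y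
    InWindow-complement {x} {y} x+y≡p (q≤x , x+q≤p) =
      +-cancelˡ-≤ x q y (≤-trans x+q≤p (≤-reflexive (sym x+y≡p))) ,
      ≤-trans (+-monoʳ-≤ y q≤x) (≤-reflexive (trans (+-comm y x) x+y≡p))

    module _ {a b d : ℕ} (d≤p : d ≤ p) (a+d≡b : a + d ≡ b ⊎ a + d ≡ b + p) where

      -- The distance is `d` or `p - d`, and the window is symmetric.
      InWindow⇒separated : InWindow d → q ≤ ∣ a - b ∣ × ∣ a - b ∣ ≤ p ∸ q
      InWindow⇒separated w with ∣a-b∣-cases d≤p a+d≡b
      ... | inj₁ eq rewrite eq = proj₁ w , m+n≤o⇒m≤o∸n d (proj₂ w)
      ... | inj₂ eq with InWindow-complement (trans (+-comm d _) eq) w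
      ...   | q≤ , ≤p = q≤ , m+n≤o⇒m≤o∸n _ ≤p

      separated⇒InWindow : q ≤ p → q ≤ ∣ a - b ∣ × ∣ a - b ∣ ≤ p ∸ q → InWindow d
      separated⇒InWindow q≤p (q≤ , ≤p∸q) with ∣a-b∣-cases d≤p a+d≡b
      ... | inj₁ eq = subst InWindow eq w
        where w = q≤ , m≤o∸n⇒m+n≤o _ q≤p ≤p∸q
      ... | inj₂ eq = InWindow-complement eq w
        where w = q≤ , m≤o∸n⇒m+n≤o _ q≤p ≤p∸q

    InWindow-<p : ∀ {x} → 0 ℕ.< q → InWindow x → x ℕ.< p
    InWindow-<p {x} 0<q (_ , x+q≤p) =
      ≤-trans (≤-trans (≤-reflexive (+-comm 1 x)) (+-monoʳ-≤ x 0<q)) x+q≤p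

-- Invariance of the wind

open Graph using (Vertex; Adj)
open Colouring

sum-const : ∀ n c → sum {n} (λ _ → c) ≡ n * c
sum-const zero    c = refl
sum-const (suc n) c = cong (λ s → c + s) (sum-const n c)

opposite-complement : ∀ {n} (i : Fin n) → toℕ (opposite i) + suc (toℕ i) ≡ n
opposite-complement i = trans (cong (_+ suc (toℕ i)) (opposite-prop i)) (m∸n+n≡m (toℕ<n i))

∣-∣-opposite : ∀ {n} (i j : Fin n) → ∣ toℕ (opposite i) - toℕ (opposite j) ∣ ≡ ∣ toℕ i - toℕ j ∣
∣-∣-opposite {n} i j = begin
  -- Adding `a + b + 1` to both arguments of the distance completes each reversed colour to `n`.
  ∣ x - y ∣                                  ≡⟨ ∣m+n-m+o∣≡∣n-o∣ (suc (a + b)) x y ⟨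
  ∣ suc (a + b) + x - suc (a + b) + y ∣      ≡⟨ cong₂ ∣_-_∣ (regroup₁ a b x) (regroup₂ a b y) ⟩
  ∣ (x + suc a) + b - (y + suc b) + a ∣
    ≡⟨ cong₂ (λ s t → ∣ s + b - t + a ∣) (opposite-complement i) (opposite-complement j) ⟩
  ∣ n + b - n + a ∣                          ≡⟨ ∣m+n-m+o∣≡∣n-o∣ n b a ⟩
  ∣ b - a ∣                                  ≡⟨ ∣-∣-comm b a ⟩
  ∣ a - b ∣                                  ∎
  where
  open ≡-Reasoning
  a = toℕ i
  b = toℕ j
  x = toℕ (opposite i)
  y = toℕ (opposite j)
  regroup₁ : ∀ a b x → suc (a + b) + x ≡ (x + suc a) + b
  regroup₁ = solve-∀
  regroup₂ : ∀ a b y → suc (a + b) + y ≡ (y + suc b) + a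
  regroup₂ = solve-∀

-- Hence, when the colours are reversed, an edge receives the weight that it had in the opposite
-- direction.
opposite-minus : ∀ {n} (i j : Fin n) →
  + toℕ (opposite j) ℤ.- + toℕ (opposite i) ≡ + toℕ i ℤ.- + toℕ j
opposite-minus {n} i j = begin
  + y ℤ.- + x
    ≡⟨ regroup (+ x) (+ y) (+ a) (+ b) (+ 1) ⟩
  (+ (y + suc b) ℤ.- + (x + suc a)) ℤ.+ (+ a ℤ.- + b)
    ≡⟨ cong₂ (λ s t → (+ s ℤ.- + t) ℤ.+ (+ a ℤ.- + b)) (opposite-complement j) (opposite-complement i) ⟩
  (+ n ℤ.- + n) ℤ.+ (+ a ℤ.- + b)
    ≡⟨ cong (λ z → z ℤ.+ (+ a ℤ.- + b)) (ℤ.+-inverseʳ (+ n)) ⟩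
  + 0 ℤ.+ (+ a ℤ.- + b)                                     ≡⟨ ℤ.+-identityˡ _ ⟩
  + a ℤ.- + b                                               ∎
  where
  open ≡-Reasoning
  a = toℕ i
  b = toℕ j
  x = toℕ (opposite i)
  y = toℕ (opposite j)
  regroup : ∀ x y a b o → y ℤ.- x ≡ ((y ℤ.+ (o ℤ.+ b)) ℤ.- (x ℤ.+ (o ℤ.+ a))) ℤ.+ (a ℤ.- b)
  regroup = ℤ-Solver.solve-∀

module _ {p q : ℕ} {G : Graph} where

  reflect : Colouring p q G → Colouring p q G
  reflect f .colour v = opposite (colour f v)
  reflect f .proper u v e rewrite ∣-∣-opposite (colour f u) (colour f v) = proper f u v e

module _ {p q : ℕ} .{{_ : NonZero p}} {G : Graph} (f : Colouring p q G) where

  weight<p : ∀ u v → weight f u v ℕ.< p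
  weight<p u v = difference<p p (toℕ (colour f u)) (toℕ (colour f v))

  weight-reflect : ∀ u v → weight (reflect f) u v ≡ weight f v u
  weight-reflect u v = cong (_%ℕ p) (opposite-minus (colour f u) (colour f v))

module _ {p q : ℕ} .{{_ : NonZero p}} (0<q : 0 ℕ.< q) (2q<p : q + q ℕ.< p) {G : Graph} where

  private
    q≤p : q ≤ p
    q≤p = ≤-trans (m≤m+n q q) (<⇒≤ 2q<p)

  module _ (f : Colouring p q G) where

    module _ {u v : Vertex G} (e : Adj G u v) where

      weight-InWindow : InWindow p q (weight f u v)
      weight-InWindow = separated⇒InWindow p q
        (<⇒≤ (weight<p f u v)) (difference-cases p (toℕ<n (colour f u)) (toℕ<n (colour f v)))
        q≤p (proper f u v e)

      weight-antisym : weight f u v + weight f v u ≡ p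
      weight-antisym = difference-antisym p (toℕ<n (colour f u)) (toℕ<n (colour f v))
        (≤-trans 0<q (proj₁ weight-InWindow))

    module _ (C : Cycle G) where
      open Cycle C using (∣E∣; vertex; adjacent)

      cycleWeight-reflect : cycleWeight f C + cycleWeight (reflect f) C ≡ ∣E∣ * p
      cycleWeight-reflect = begin
        cycleWeight f C + cycleWeight (reflect f) C  ≡⟨ ∑-distrib-+ w w′ ⟨
        sum (λ i → w i + w′ i)                       ≡⟨ sum-cong-≗ complementary ⟩
        sum {∣E∣} (λ _ → p)                          ≡⟨ sum-const ∣E∣ p ⟩
        ∣E∣ * p                                      ∎
        where
        open ≡-Reasoning
        w w′ : Fin ∣E∣ → ℕ
        w i = weight f (vertex i) (vertex (next i))
        w′ i = weight (reflect f) (vertex i) (vertex (next i))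
        complementary : ∀ i → w i + w′ i ≡ p
        complementary i = trans
          (cong (λ x → w i + x) (weight-reflect f (vertex i) (vertex (next i))))
          (weight-antisym (adjacent i))

  module _ (p<4q : p ℕ.< (q + q) + (q + q)) where

    -- The colour change r is lifted to the integer congruent to it in
    -- [−(p − 2q), p − 2q], which is unique as p < 4q; p is added to stay in ℕ.
    lift : ℕ → ℕ
    lift r with r + (q + q) ≤? p
    ... | yes _ = r + p
    ... | no  _ = r

    lift-0 : lift 0 ≡ p
    lift-0 with q + q ≤? p
    ... | yes _  = refl
    ... | no 2q≰p = contradiction (<⇒≤ 2q<p) 2q≰p

    -- `w′ - w` lies between `-(p - 2q)` and `p - 2q` and is congruent to `r`, so it is the lifted
    -- change. Two of the four cases contradict the bounds.
    lift-spec : ∀ {w w′ r} → InWindow p q w → InWindow p q w′ → r ℕ.< p →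
      (w + r) % p ≡ w′ % p → w′ + p ≡ w + lift r
    lift-spec {w} {w′} {r} W@(q≤w , w+q≤p) W′@(_ , w′+q≤p) r<p w+r≡w′
      with r + (q + q) ≤? p
         | residue-cases p (+-mono-< (InWindow-<p p q 0<q W) r<p) (InWindow-<p p q 0<q W′) w+r≡w′
    ... | yes _ | inj₁ refl = +-assoc w r p
    ... | no  _ | inj₂ eq   = sym eq
    ... | no ¬small | inj₁ refl = contradiction (begin
      r + (q + q)  ≡⟨ rotate r q ⟩
      q + r + q    ≤⟨ +-monoˡ-≤ q (+-monoˡ-≤ r q≤w) ⟩
      w + r + q    ≤⟨ w′+q≤p ⟩
      p            ∎) ¬small
      where
      open ≤-Reasoning
      rotate : ∀ r q → r + (q + q) ≡ q + r + q
      rotate = solve-∀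
    -- Here `p<4q` enters: wrapping around with `r ≤ p - 2q` gives `q + p ≤ w′ + p = w + r ≤ (p - q)
    -- + (p - 2q)`.
    ... | yes small | inj₂ eq = contradiction p<4q (≤⇒≯ (+-cancelʳ-≤ p _ _ (begin
      (q + q) + (q + q) + p         ≤⟨ +-monoˡ-≤ p (+-monoˡ-≤ (q + q) (+-monoˡ-≤ q (proj₁ W′))) ⟩
      (w′ + q) + (q + q) + p        ≡⟨ regroup₁ w′ q p ⟩
      (w′ + p) + (q + (q + q))      ≡⟨ cong (_+ (q + (q + q))) eq ⟨
      (w + r) + (q + (q + q))       ≡⟨ regroup₂ w r q ⟩
      (w + q) + (r + (q + q))       ≤⟨ +-mono-≤ w+q≤p small ⟩
      p + p                         ∎)))
      where
      open ≤-Reasoning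
      regroup₁ : ∀ w q p → (w + q) + (q + q) + p ≡ (w + p) + (q + (q + q))
      regroup₁ = solve-∀
      regroup₂ : ∀ w r q → (w + r) + (q + (q + q)) ≡ (w + q) + (r + (q + q))
      regroup₂ = solve-∀

    module _ {f g : Colouring p q G} (step : DifferOnAtMostOneVertex f g) where

      private
        a b : Vertex G → ℕ
        a v = toℕ (colour f v)
        b v = toℕ (colour g v)

        σ : Vertex G → ℕ
        σ v = lift (difference p (a v) (b v))

        a≤p : ∀ v → a v ≤ p
        a≤p v = <⇒≤ (toℕ<n (colour f v))

        σ-fixed : ∀ {v} → colour f v ≡ colour g v → σ v ≡ p
        σ-fixed {v} eq rewrite eq = trans (cong lift (difference-self p (b v))) lift-0

      -- The weight changes by the difference of the potential `σ`, the lifted colour change. One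
      -- end of the edge keeps its colour, which leaves a single lifted change for `lift-spec`.
      weight-step : ∀ {u v} → Adj G u v → weight g u v + σ u ≡ weight f u v + σ v
      weight-step {u} {v} e with colour f u ≟ colour g u | colour f v ≟ colour g v
      ... | yes fu≡gu | _ = trans (cong (λ s → weight g u v + s) (σ-fixed fu≡gu))
        (lift-spec (weight-InWindow f e) (weight-InWindow g e) (difference<p p (a v) (b v))
          (+-cancelˡ-% p (a≤p u) (begin
            (a u + (weight f u v + difference p (a v) (b v))) % p
              ≡⟨ cong (_% p) (+-assoc (a u) (weight f u v) _) ⟨
            (a u + weight f u v + difference p (a v) (b v)) % p
              ≡⟨ +-congʳ-% p _ (a+difference p (a u) (a v)) ⟩
            (a v + difference p (a v) (b v)) % p                   ≡⟨ a+difference p (a v) (b v) ⟩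
            b v % p                                                ≡⟨ a+difference p (b u) (b v) ⟨
            (b u + weight g u v) % p
              ≡⟨ cong (λ c → (toℕ c + weight g u v) % p) fu≡gu ⟨
            (a u + weight g u v) % p                               ∎)))
        where open ≡-Reasoning
      -- A change at the tail acts on the weight with the opposite sign, so `f` and `g` exchange
      -- their roles.
      ... | no _ | yes fv≡gv = sym (trans (cong (λ s → weight f u v + s) (σ-fixed fv≡gv))
        (lift-spec (weight-InWindow g e) (weight-InWindow f e) (difference<p p (a u) (b u))
          (+-cancelˡ-% p (a≤p u) (begin
            (a u + (weight g u v + difference p (a u) (b u))) % p
              ≡⟨ cong (_% p) (swap (a u) (weight g u v) _) ⟩
            (a u + difference p (a u) (b u) + weight g u v) % p
              ≡⟨ +-congʳ-% p _ (a+difference p (a u) (b u)) ⟩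
            (b u + weight g u v) % p                               ≡⟨ a+difference p (b u) (b v) ⟩
            b v % p                                                ≡⟨ cong (λ c → toℕ c % p) fv≡gv ⟨
            a v % p                                                ≡⟨ a+difference p (a u) (a v) ⟨
            (a u + weight f u v) % p                               ∎))))
        where
        open ≡-Reasoning
        swap : ∀ x y z → x + (y + z) ≡ x + z + y
        swap = solve-∀
      ... | no fu≢gu | no fv≢gv with step u v fu≢gu fv≢gv
      ...   | refl = contradiction e (Graph.irrefl G u)

      -- The potentials cancel around the cycle, since summing over successors is summing over all
      -- vertices.
      cycleWeight-step : ∀ C → cycleWeight f C ≡ cycleWeight g C
      cycleWeight-step C = sym (+-cancelʳ-≡ (sum (σ ∘ vertex)) _ _ (begin
        cycleWeight g C + sum (σ ∘ vertex)
          ≡⟨ ∑-distrib-+ (λ i → weight g (vertex i) (vertex (next i))) (σ ∘ vertex) ⟨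
        sum (λ i → weight g (vertex i) (vertex (next i)) + σ (vertex i))
          ≡⟨ sum-cong-≗ (λ i → weight-step (adjacent i)) ⟩
        sum (λ i → weight f (vertex i) (vertex (next i)) + σ (vertex (next i)))
          ≡⟨ ∑-distrib-+ (λ i → weight f (vertex i) (vertex (next i))) (σ ∘ vertex ∘ next) ⟩
        cycleWeight f C + sum (σ ∘ vertex ∘ next)
          ≡⟨ cong (λ s → cycleWeight f C + s) (sum-next (σ ∘ vertex)) ⟩
        cycleWeight f C + sum (σ ∘ vertex) ∎))
        where
        open ≡-Reasoning
        open Cycle C using (vertex; adjacent)

    cycleWeight-invariant : ∀ {f g : Colouring p q G} → Star DifferOnAtMostOneVertex f g →
      ∀ C → cycleWeight f C ≡ cycleWeight g C
    cycleWeight-invariant ε C = refl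
    cycleWeight-invariant {f} (_◅_ {j = h} step steps) C =
      trans (cycleWeight-step {f} {h} step C) (cycleWeight-invariant {h} steps C)

    -- By invariance a colouring and its reversal give `C` the same weight, and the two weights add
    -- up to `∣E∣ * p`.
    mixing⇒wind : Mixing p q G → (f : Colouring p q G) (C : Cycle G) → wind f C * 2 ≡ Cycle.∣E∣ C
    mixing⇒wind mix f C = *-cancelʳ-≡ (wind f C * 2) ∣E∣ p (begin
      wind f C * 2 * p                             ≡⟨ double (wind f C) p ⟩
      p * wind f C + p * wind f C                  ≡⟨ cong (λ w → w + w) (cycleWeight≡p*wind f C) ⟨
      cycleWeight f C + cycleWeight f C
        ≡⟨ cong (λ w → cycleWeight f C + w) (cycleWeight-invariant (mix f (reflect f)) C) ⟩
      cycleWeight f C + cycleWeight (reflect f) C  ≡⟨ cycleWeight-reflect f C ⟩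
      ∣E∣ * p                                      ∎)
      where
      open ≡-Reasoning
      open Cycle C using (∣E∣)
      double : ∀ w p → w * 2 * p ≡ p * w + p * w
      double = solve-∀

-- Reconfiguration of height functions

sum-mono-≤ : ∀ {n} {f g : Fin n → ℕ} → (∀ i → f i ≤ g i) → sum f ≤ sum g
sum-mono-≤ {zero}  f≤g = z≤n
sum-mono-≤ {suc n} f≤g = +-mono-≤ (f≤g zero) (sum-mono-≤ (f≤g ∘ suc))

sum-updateAt-suc : ∀ {n} (f : Fin n → ℕ) i → sum (updateAt f i suc) ≡ suc (sum f)
sum-updateAt-suc f zero    = refl
sum-updateAt-suc f (suc i) = trans (cong (λ s → f zero + s) (sum-updateAt-suc (f ∘ suc) i)) (+-suc (f zero) _)

minimum : ∀ {n} {P : Fin n → Set} → Decidable P → (h : Fin n → ℕ) →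
  (∀ i → ¬ P i) ⊎ ∃ λ i → P i × (∀ j → P j → h i ≤ h j)
minimum {zero}  P? h = inj₁ λ ()
minimum {suc n} P? h with P? zero | minimum (P? ∘ suc) (h ∘ suc)
... | no ¬p₀ | inj₁ none           = inj₁ λ { zero → ¬p₀ ; (suc i) → none i }
... | no ¬p₀ | inj₂ (i , pᵢ , min) = inj₂ (suc i , pᵢ , λ
  { zero p₀ → contradiction p₀ ¬p₀ ; (suc j) → min j })
... | yes p₀ | inj₁ none           = inj₂ (zero , p₀ , λ
  { zero _ → ≤-refl ; (suc j) pⱼ → contradiction pⱼ (none j) })
... | yes p₀ | inj₂ (i , pᵢ , min) with ≤-total (h zero) (h (suc i))
...   | inj₁ h₀≤ = inj₂ (zero , p₀ , λ { zero _ → ≤-refl ; (suc j) pⱼ → ≤-trans h₀≤ (min j pⱼ) })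
...   | inj₂ ≤h₀ = inj₂ (suc i , pᵢ , λ { zero _ → ≤h₀ ; (suc j) → min j })

double-+ : ∀ a b → (a + b) + (a + b) ≡ a + a + (b + b)
double-+ = solve-∀

module _ {p q : ℕ} {G : Graph} where

  ≗⇒step : {f g : Colouring p q G} → (∀ v → colour f v ≡ colour g v) → DifferOnAtMostOneVertex f g
  ≗⇒step f≗g u _ fu≢gu _ = contradiction (f≗g u) fu≢gu

  step-sym : {f g : Colouring p q G} → DifferOnAtMostOneVertex f g → DifferOnAtMostOneVertex g f
  step-sym step u v gu≢fu gv≢fv = step u v (gu≢fu ∘ sym) (gv≢fv ∘ sym)

module Heights {p q : ℕ} .{{_ : NonZero p}} (0<q : 0 ℕ.< q) (2q<p : q + q ℕ.< p) {G : Graph}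
  (side : Vertex G → Fin 2) where

  Arc : Vertex G → Vertex G → Set
  Arc u v = Adj G u v × side u ≡ zero × side v ≡ suc zero

  Height : (Vertex G → ℕ) → Set
  Height k = ∀ {u v} → Arc u v → k u + q ≤ k v × k v + q ≤ k u + p

  -- Each condition compares the values at two vertices up to added constants, and addition
  -- distributes over maxima.
  Height-⊔ : ∀ {k l} → Height k → Height l → Height (λ v → k v ⊔ l v)
  Height-⊔ {k} {l} K L {u} {v} a =
    ≤-trans (≤-reflexive (+-distribʳ-⊔ q (k u) (l u))) (⊔-mono-≤ (proj₁ (K a)) (proj₁ (L a))) ,
    subst₂ _≤_ (sym (+-distribʳ-⊔ q (k v) (l v))) (sym (+-distribʳ-⊔ p (k u) (l u)))
      (⊔-mono-≤ (proj₂ (K a)) (proj₂ (L a)))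

  -- Twice the height raised by `p / 2` on the first side; doubling avoids the fraction.
  level : (Vertex G → ℕ) → Vertex G → ℕ
  level k v with side v
  ... | zero     = k v + k v + p
  ... | suc zero = k v + k v

  level₀ : ∀ k {v} → side v ≡ zero → level k v ≡ k v + k v + p
  level₀ k {v} eq with side v
  level₀ k {v} refl | zero = refl

  level₁ : ∀ k {v} → side v ≡ suc zero → level k v ≡ k v + k v
  level₁ k {v} eq with side v
  level₁ k {v} refl | suc zero = refl

  module _ {k l : Vertex G → ℕ} (K : Height k) (L : Height l) where

    -- A neighbour blocking x has a smaller level, because 2q < p, and is below l too.
    raise : ∀ {x} → k x ℕ.< l x → (∀ y → k y ℕ.< l y → level k x ≤ level k y) →
      Height (updateAt k x suc)
    raise {x} kx<lx lowest {u} {v} a@(e , su , sv) with u ≟ x | v ≟ x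
    ... | yes refl | yes refl = contradiction e (Graph.irrefl G u)
    ... | no u≢x | no v≢x
      rewrite updateAt-minimal u x {suc} k u≢x | updateAt-minimal v x {suc} k v≢x = K a
    ... | yes refl | no v≢x
      rewrite updateAt-updates u {suc} k | updateAt-minimal v u {suc} k v≢x =
      -- Raising the tail relaxes the upper bound; the lower one must not be attained beforehand.
      ≤∧≢⇒< (proj₁ (K a)) unblocked , m≤n⇒m≤1+n (proj₂ (K a))
      where
      open ≤-Reasoning
      unblocked : k u + q ≢ k v
      unblocked eq = <⇒≱ (begin-strict
        level k v                ≡⟨ level₁ k sv ⟩
        k v + k v                ≡⟨ cong₂ _+_ eq eq ⟨
        (k u + q) + (k u + q)    ≡⟨ double-+ (k u) q ⟩
        k u + k u + (q + q)      <⟨ +-monoʳ-< (k u + k u) 2q<p ⟩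
        k u + k u + p            ≡⟨ level₀ k su ⟨
        level k u                ∎)
        (lowest v (begin-strict
          k v      ≡⟨ eq ⟨
          k u + q  <⟨ +-monoˡ-< q kx<lx ⟩
          l u + q  ≤⟨ proj₁ (L a) ⟩
          l v      ∎))
    ... | no u≢x | yes refl
      rewrite updateAt-updates v {suc} k | updateAt-minimal u v {suc} k u≢x =
      -- For the head it is the upper bound that must not be attained.
      m≤n⇒m≤1+n (proj₁ (K a)) , ≤∧≢⇒< (proj₂ (K a)) unblocked
      where
      open ≤-Reasoning
      unblocked : k v + q ≢ k u + p
      unblocked eq = <⇒≱ (+-cancelʳ-< p _ _ (begin-strict
        level k u + p            ≡⟨ cong (_+ p) (level₀ k su) ⟩
        k u + k u + p + p        ≡⟨ +-assoc (k u + k u) p p ⟩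
        k u + k u + (p + p)      ≡⟨ double-+ (k u) p ⟨
        (k u + p) + (k u + p)    ≡⟨ cong₂ _+_ eq eq ⟨
        (k v + q) + (k v + q)    ≡⟨ double-+ (k v) q ⟩
        k v + k v + (q + q)      <⟨ +-monoʳ-< (k v + k v) 2q<p ⟩
        k v + k v + p            ≡⟨ cong (_+ p) (level₁ k sv) ⟨
        level k v + p            ∎))
        (lowest u (+-cancelʳ-< p _ _ (begin-strict
          k u + p  ≡⟨ eq ⟨
          k v + q  <⟨ +-monoˡ-< q kx<lx ⟩
          l v + q  ≤⟨ proj₂ (L a) ⟩
          l u + p  ∎)))

  module _ (bipartite : ∀ {u v} → Adj G u v → Arc u v ⊎ Arc v u) where

    private
      -- The rise along an arc is less than `p`, hence it is the residue of the difference of the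
      -- reduced heights.
      separated : ∀ {k} → Height k → ∀ {u v} → Arc u v →
        q ≤ ∣ toℕ (k u mod p) - toℕ (k v mod p) ∣ × ∣ toℕ (k u mod p) - toℕ (k v mod p) ∣ ≤ p ∸ q
      separated {k} K {u} {v} a
        rewrite toℕ-fromℕ< (m%n<n (k u) p) | toℕ-fromℕ< (m%n<n (k v) p)
        with m≤n⇒∃[o]m+o≡n (≤-trans (m≤m+n (k u) q) (proj₁ (K a)))
      ... | d , ku+d≡kv = InWindow⇒separated p q (<⇒≤ d<p) cases window
        where
        open ≡-Reasoning
        window : InWindow p q d
        window = +-cancelˡ-≤ (k u) q d (≤-trans (proj₁ (K a)) (≤-reflexive (sym ku+d≡kv))) ,
                 +-cancelˡ-≤ (k u) (d + q) p (≤-trans (≤-reflexive ku+d+q≡kv+q) (proj₂ (K a)))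
          where
          ku+d+q≡kv+q : k u + (d + q) ≡ k v + q
          ku+d+q≡kv+q = trans (sym (+-assoc (k u) d q)) (cong (_+ q) ku+d≡kv)
        d<p : d ℕ.< p
        d<p = InWindow-<p p q 0<q window
        cases : k u % p + d ≡ k v % p ⊎ k u % p + d ≡ k v % p + p
        cases = residue-cases p (+-mono-< (m%n<n (k u) p) d<p) (m%n<n (k v) p) (begin
          (k u % p + d) % p  ≡⟨ +-congʳ-% p d (m%n%n≡m%n (k u) p) ⟩
          (k u + d) % p      ≡⟨ cong (_% p) ku+d≡kv ⟩
          k v % p            ≡⟨ m%n%n≡m%n (k v) p ⟨
          k v % p % p        ∎)

    colouring : ∀ {k} → Height k → Colouring p q G
    colouring {k} K .colour v = k v mod p
    colouring {k} K .proper u v e with bipartite e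
    ... | inj₁ a = separated K a
    ... | inj₂ a = subst (λ d → q ≤ d × d ≤ p ∸ q) (∣-∣-comm (toℕ (k v mod p)) (toℕ (k u mod p))) (separated K a)

    private
      -- `n` bounds the distance `sum l - sum k`, which every raising decreases by one; the
      -- recursion is on `n`.
      climb : ∀ n {k l} (K : Height k) (L : Height l) → (∀ v → k v ≤ l v) → sum l ≤ n + sum k →
        Star DifferOnAtMostOneVertex (colouring K) (colouring L)
      climb n {k} {l} K L k≤l fuel with minimum (λ v → k v <? l v) (level k)
      ... | inj₁ none = ≗⇒step {f = colouring K} {g = colouring L}
        (λ v → cong (_mod p) (≤-antisym (k≤l v) (≮⇒≥ (none v)))) ◅ ε
      ... | inj₂ (x , kx<lx , lowest) = continue n fuel
        where
        k′ : Vertex G → ℕ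
        k′ = updateAt k x suc
        K′ : Height k′
        K′ = raise K L kx<lx lowest
        k′≤l : ∀ v → k′ v ≤ l v
        k′≤l v with v ≟ x
        ... | yes refl rewrite updateAt-updates v {suc} k = kx<lx
        ... | no  v≢x  rewrite updateAt-minimal v x {suc} k v≢x = k≤l v
        changed : ∀ v → colour (colouring K) v ≢ colour (colouring K′) v → v ≡ x
        changed v neq with v ≟ x
        ... | yes v≡x = v≡x
        ... | no  v≢x = contradiction (cong (_mod p) (sym (updateAt-minimal v x k v≢x))) neq
        continue : ∀ n → sum l ≤ n + sum k → Star DifferOnAtMostOneVertex (colouring K) (colouring L)
        -- The raised `k′` is still below `l` and its sum exceeds that of `k` by one, so the bound
        -- cannot be 0.
        continue zero    fuel = contradiction fuel
          (<⇒≱ (≤-trans (≤-reflexive (sym (sum-updateAt-suc k x))) (sum-mono-≤ k′≤l)))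
        continue (suc n) fuel =
          _◅_ {j = colouring K′} (λ u v u≢ v≢ → trans (changed u u≢) (sym (changed v v≢)))
            (climb n K′ L k′≤l (≤-trans fuel (≤-reflexive
              (trans (sym (+-suc n (sum k))) (cong (λ s → n + s) (sym (sum-updateAt-suc k x)))))))

    connected : ∀ {k l} (K : Height k) (L : Height l) →
      Star DifferOnAtMostOneVertex (colouring K) (colouring L)
    connected {k} {l} K L =
      -- The bound is inferred to be the sum of the maximum.
      climb _ K M (λ v → m≤m⊔n (k v) (l v)) (m≤m+n _ _) ◅◅
      Star.reverse (λ {f} {g} → step-sym {f = f} {g})
        (climb _ L M (λ v → m≤n⊔m (k v) (l v)) (m≤m+n _ _))
      where
      M : Height (λ v → k v ⊔ l v)
      M = Height-⊔ K L

-- Height functions from colourings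

bounded : ∀ {n} (f : Fin n → ℕ) → ∃ λ M → ∀ i → f i ≤ M
bounded {zero}  f = 0 , λ ()
bounded {suc n} f with bounded (f ∘ suc)
... | M , f≤M = f zero ⊔ M , λ { zero → m≤m⊔n _ _ ; (suc i) → ≤-trans (f≤M i) (m≤n⊔m _ _) }

odd≢even : ∀ m n → suc (m * 2) ≢ n * 2
odd≢even zero    (suc n) ()
odd≢even (suc m) (suc n) eq = odd≢even m n (suc-injective (suc-injective eq))

module _ {p q : ℕ} .{{_ : NonZero p}} {G : Graph} where

  -- Weights are congruent to differences of colours, so they telescope along a walk.
  colour-walk : (f : Colouring p q G) → ∀ {u v} (x : Walk {G} u v) →
    (toℕ (colour f u) + total (weight f) x) % p ≡ toℕ (colour f v)
  colour-walk f ([] {u}) = trans (cong (_% p) (+-identityʳ _)) (m<n⇒m%n≡m (toℕ<n (colour f u)))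
  colour-walk f (_∷_ {u} {v} e x) = begin
    (toℕ (colour f u) + (weight f u v + total (weight f) x)) % p
      ≡⟨ cong (_% p) (+-assoc (toℕ (colour f u)) (weight f u v) (total (weight f) x)) ⟨
    (toℕ (colour f u) + weight f u v + total (weight f) x) % p
      ≡⟨ +-congʳ-% p (total (weight f) x) (a+difference p (toℕ (colour f u)) (toℕ (colour f v))) ⟩
    (toℕ (colour f v) + total (weight f) x) % p                   ≡⟨ colour-walk f x ⟩
    toℕ (colour f _)                                              ∎
    where open ≡-Reasoning

module _ {p q : ℕ} .{{_ : NonZero p}} (0<q : 0 ℕ.< q) (2q<p : q + q ℕ.< p) {G : Graph} where

  module _ (winds : (f : Colouring p q G) (C : Cycle G) → wind f C * 2 ≡ Cycle.∣E∣ C)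
    (F : Forest G) (root-cong : ∀ {u v} → Adj G u v → Forest.root F u ≡ Forest.root F v) where

    open Forest F

    private
      length-mod-2 : ∀ v → DivMod (length (path v)) 2
      length-mod-2 v = length (path v) divMod 2

      half : Vertex G → ℕ
      half v = DivMod.quotient (length-mod-2 v)

      -- The parity of the path length. It depends on the forest only, so the heights of all
      -- colourings share one bipartition.
      side : Vertex G → Fin 2
      side v = DivMod.remainder (length-mod-2 v)

      length-path : ∀ v → length (path v) ≡ toℕ (side v) + half v * 2
      length-path v = DivMod.property (length-mod-2 v)

      open Heights {p} {q} 0<q 2q<p {G} side

      M : ℕ
      M = proj₁ (bounded half)

    module _ (f : Colouring p q G) where

      private
        S : Vertex G → ℕ
        S v = total (weight f) (path v)

        edge : ∀ {u v} → Adj G u v → ∃ λ m → length (path u) + suc (length (path v)) ≡ m * 2 ×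
          S u + weight f u v + length (path v) * p ≡ m * p + S v
        edge {u} {v} e = edge-balanced p (weight f) (weight-antisym 0<q 2q<p f)
          (λ C → wind f C , sym (winds f C) , trans (cycleWeight≡p*wind f C) (*-comm p (wind f C)))
          (root-cong e) (path u) (path v) e

      -- Subtracting half v * p makes the height rise by the weight along every arc;
      -- the bound M on half keeps it in ℕ.
      height : Vertex G → ℕ
      height v = toℕ (colour f (root v)) + S v + (M ∸ half v) * p

      height-colour : ∀ v → height v % p ≡ toℕ (colour f v)
      height-colour v = trans ([m+kn]%n≡m%n _ (M ∸ half v) p) (colour-walk f (path v))

      -- The closed walk through both paths and the edge has even length, so the sides differ. It is
      -- through the colouring `f` that `winds` speaks about the cycles of `G`.
      bipartite : ∀ {u v} → Adj G u v → Arc u v ⊎ Arc v u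
      bipartite {u} {v} e = orient (side u) (side v) refl refl
        where
        lengths : ∀ {s t} → side u ≡ s → side v ≡ t →
          (toℕ s + half u * 2) + suc (toℕ t + half v * 2) ≡ proj₁ (edge e) * 2
        lengths refl refl = trans
          (cong₂ (λ l l′ → l + suc l′) (sym (length-path u)) (sym (length-path v)))
          (proj₁ (proj₂ (edge e)))
        same₀ : ∀ a b → suc ((a + b) * 2) ≡ a * 2 + suc (b * 2)
        same₀ = solve-∀
        same₁ : ∀ a b → suc (suc (a + b) * 2) ≡ suc (a * 2) + suc (suc (b * 2))
        same₁ = solve-∀
        orient : ∀ s t → side u ≡ s → side v ≡ t → Arc u v ⊎ Arc v u
        orient zero       (suc zero) su sv = inj₁ (e , su , sv)
        orient (suc zero) zero       su sv = inj₂ (Graph.symm G e , sv , su)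
        orient zero       zero       su sv = contradiction
          (trans (same₀ (half u) (half v)) (lengths su sv)) (odd≢even (half u + half v) (proj₁ (edge e)))
        orient (suc zero) (suc zero) su sv = contradiction
          (trans (same₁ (half u) (half v)) (lengths su sv)) (odd≢even (suc (half u + half v)) (proj₁ (edge e)))

      height-arc : ∀ {u v} → Arc u v → height u + weight f u v ≡ height v
      height-arc {u} {v} (e , su , sv) with edge e
      -- The cancelled multiple of `p` completes both truncated subtractions to `M` and supplies the
      -- term `length (path v) * p` of the edge equation.
      ... | m , l≡ , t≡ = +-cancelʳ-≡ ((half u + suc (half v * 2) + half v) * p) _ _ (begin
        c u + S u + d u * p + w + (half u + suc (half v * 2) + half v) * p
          ≡⟨ regroup₁ (c u) (S u) (d u) w (half u) (half v) p ⟩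
        c u + (d u + half u) * p + half v * p + (S u + w + suc (half v * 2) * p)
          ≡⟨ cong₂ (λ s t → c u + s * p + half v * p + t) (m∸n+n≡m (half≤M u)) t′ ⟩
        c u + M * p + half v * p + ((half u + suc (half v)) * p + S v)
          ≡⟨ cong₂ (λ s t → s + t * p + half v * p + ((half u + suc (half v)) * p + S v))
               (cong (toℕ ∘ colour f) (root-cong e)) (sym (m∸n+n≡m (half≤M v))) ⟩
        c v + (d v + half v) * p + half v * p + ((half u + suc (half v)) * p + S v)
          ≡⟨ regroup₂ (c v) (S v) (d v) (half u) (half v) p ⟩
        c v + S v + d v * p + (half u + suc (half v * 2) + half v) * p ∎)
        where
        open ≡-Reasoning
        w = weight f u v
        c d : Vertex G → ℕ
        c x = toℕ (colour f (root x))
        d x = M ∸ half x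
        half≤M : ∀ x → half x ≤ M
        half≤M = proj₂ (bounded half)
        lv : length (path v) ≡ suc (half v * 2)
        lv = trans (length-path v) (cong (λ s → toℕ s + half v * 2) sv)
        -- Half the length of the closed walk: the paths have lengths `half u * 2` and
        -- `half v * 2 + 1`, and the edge adds 1.
        m≡ : m ≡ half u + suc (half v)
        m≡ = *-cancelʳ-≡ m (half u + suc (half v)) 2 (trans (sym l≡) (trans
          (cong₂ (λ s t → s + suc t) (trans (length-path u) (cong (λ s → toℕ s + half u * 2) su)) lv)
          (collect (half u) (half v))))
          where
          collect : ∀ a b → a * 2 + suc (suc (b * 2)) ≡ (a + suc b) * 2
          collect = solve-∀
        t′ : S u + w + suc (half v * 2) * p ≡ (half u + suc (half v)) * p + S v
        t′ = trans (cong (λ l → S u + w + l * p) (sym lv)) (trans t≡ (cong (λ n → n * p + S v) m≡))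
        regroup₁ : ∀ c s d w a b p → c + s + d * p + w + (a + suc (b * 2) + b) * p
          ≡ c + (d + a) * p + b * p + (s + w + suc (b * 2) * p)
        regroup₁ = solve-∀
        regroup₂ : ∀ c s d a b p → c + (d + b) * p + b * p + ((a + suc b) * p + s)
          ≡ c + s + d * p + (a + suc (b * 2) + b) * p
        regroup₂ = solve-∀

      height-Height : Height height
      height-Height {u} {v} a@(e , _) =
        (begin
          height u + q                 ≤⟨ +-monoʳ-≤ (height u) (proj₁ window) ⟩
          height u + weight f u v      ≡⟨ height-arc a ⟩
          height v                     ∎) ,
        (begin
          height v + q                     ≡⟨ cong (_+ q) (height-arc a) ⟨
          height u + weight f u v + q      ≡⟨ +-assoc (height u) (weight f u v) q ⟩
          height u + (weight f u v + q)    ≤⟨ +-monoʳ-≤ (height u) (proj₂ window) ⟩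
          height u + p                     ∎)
        where
        open ≤-Reasoning
        window : InWindow p q (weight f u v)
        window = weight-InWindow 0<q 2q<p f e

    -- Reducing the heights modulo `p` returns the colours, but in other `Colouring` records; so the
    -- first and the last step change no colour.
    forest⇒mixing : Mixing p q G
    forest⇒mixing f g =
      ≗⇒step {f = f} {g = f₁} (sym ∘ same f) ◅
      (connected (bipartite f) (height-Height f) (height-Height g) ◅◅
      (≗⇒step {f = g₁} {g = g} (same g) ◅ ε))
      where
      f₁ g₁ : Colouring p q G
      f₁ = colouring (bipartite f) (height-Height f)
      -- The orientation obtained from `f` serves both ends, so that `connected` applies.
      g₁ = colouring (bipartite f) (height-Height g)
      same : ∀ h v → height h v mod p ≡ colour h v
      same h v = toℕ-injective (trans (toℕ-fromℕ< (m%n<n (height h v) p)) (height-colour h v))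

  wind⇒mixing : ((f : Colouring p q G) (C : Cycle G) → wind f C * 2 ≡ Cycle.∣E∣ C) → Mixing p q G
  wind⇒mixing winds with spanningForest G
  ... | F , root-cong = forest⇒mixing winds F root-cong

-- From fractions to natural numbers

n/1<p/q⇒n*q<p : ∀ n p q .{{_ : NonZero q}} → + n / 1 < + p / q → n * q ℕ.< p
-- Matching `q` with `suc` lets the fraction `+ p / q` compute.
n/1<p/q⇒n*q<p n p q@(suc _) lt = ℤ.drop‿+<+
  (subst₂ ℤ._<_ (sym (ℤ.pos-* n q)) (ℤ.*-identityʳ (+ p)) (drop-*<* lt))

p/q<n/1⇒p<n*q : ∀ n p q .{{_ : NonZero q}} → + p / q < + n / 1 → p ℕ.< n * q
p/q<n/1⇒p<n*q n p q@(suc _) lt = ℤ.drop‿+<+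
  (subst₂ ℤ._<_ (ℤ.*-identityʳ (+ p)) (sym (ℤ.pos-* n q)) (drop-*<* lt))

m*2≡n⇒m/1≃n/2 : ∀ {m n} → m * 2 ≡ n → + m / 1 ≃ + n / 2
m*2≡n⇒m/1≃n/2 {m} {n} eq = *≡* (trans (sym (ℤ.pos-* m 2)) (trans (cong +_ eq) (sym (ℤ.*-identityʳ (+ n)))))

m/1≃n/2⇒m*2≡n : ∀ {m n} → + m / 1 ≃ + n / 2 → m * 2 ≡ n
m/1≃n/2⇒m*2≡n {m} {n} eq = ℤ.+-injective
  (trans (ℤ.pos-* m 2) (trans (drop-*≡* eq) (ℤ.*-identityʳ (+ n))))

theorem2p5 : (p q : ℕ) .{{_ : NonZero p}} .{{_ : NonZero q}} →
    + 2 / 1 < + p / q → + p / q < + 4 / 1 →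
    (G : Graph) →
    Mixing p q G ⇔
    ((f : Colouring p q G) (C : Cycle G) →
    + wind f C / 1 ≃ + Cycle.∣E∣ C / 2)
theorem2p5 p q 2<p/q p/q<4 G = mk⇔
  (λ mix f C → m*2≡n⇒m/1≃n/2 (mixing⇒wind 0<q 2q<p p<4q mix f C))
  (λ winds → wind⇒mixing 0<q 2q<p (λ f C → m/1≃n/2⇒m*2≡n (winds f C)))
  where
  0<q : 0 ℕ.< q
  0<q = >-nonZero⁻¹ q
  2q<p : q + q ℕ.< p
  2q<p = subst (ℕ._< p) (cong (λ s → q + s) (+-identityʳ q)) (n/1<p/q⇒n*q<p 2 p q 2<p/q)
  p<4q : p ℕ.< (q + q) + (q + q)
  p<4q = subst (p ℕ.<_) (quadruple q) (p/q<n/1⇒p<n*q 4 p q p/q<4)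
    where
    quadruple : ∀ q → 4 * q ≡ (q + q) + (q + q)
    quadruple = solve-∀
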